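{- Let $s<t$ be relatively prime positive integers. Let $\Delta$ be any $(s,t)$-closed delta-set and $\beta$ any $(s,t)$-closed beta-set such that $\beta\subset\Delta$. Then $\beta\prec\Delta$.
   Context: A beta-set is a finite set of positive integers, written in decreasing order $\beta=\{\beta_1>\dots>\beta_n\}$; its associated partition is $P(\beta)=(\beta_1-(n-1),\beta_2-(n-2),\dots,\beta_n)$. For partitions $P=(P_1,\dots,P_n)$, $Q=(Q_1,\dots,Q_m)$ (finite non-increasing sequences of positive integers) write $P<Q$ if $n\le m$ and $P_i\le Q_i$ for all $i\le n$; for beta-sets $\beta\prec\gamma$ means $P(\beta)<P(\gamma)$. A beta-set $\beta$ is $(s,t)$-closed if for every $x\in\beta$: $x>s$ implies $x-s\in\beta$, and $x>t$ implies $x-t\in\beta$. The $(s,t)$-closure of a set $\beta$ of positive integers is $\overline{\beta}=\{x-as-bt : x\in\beta,\ a,b\ge0,\ x>as+bt\}$. A delta-set is a set of the form $\overline{\{n\}}$ for a positive integer $n$ (its generator). -}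

module Defs where

open import Data.Nat using (ℕ; zero; suc; _+_; _*_; _∸_; _≤_; _<_)
open import Data.List using (List; []; _∷_; length)
open import Data.List.Relation.Unary.All using (All)
open import Data.List.Relation.Unary.Linked using (Linked)
open import Data.List.Membership.Propositional using (_∈_)
open import Data.Product using (Σ; ∃; _×_; _,_)
open import Relation.Binary.PropositionalEquality using (_≡_)

-- A beta-set: a finite set of positive integers, represented by the list of
-- its elements written in strictly decreasing order  β₁ > β₂ > … > βₙ.
record BetaSet : Set where
  constructor mkBeta
  field
    elems    : List ℕ
    decr     : Linked (λ x y → y < x) elems
    positive : All (λ x → 0 < x) elems
open BetaSet public

_∈β_ : ℕ → BetaSet → Set
x ∈β β = x ∈ elems β

_⊆β_ : BetaSet → BetaSet → Set
β ⊆β γ = ∀ x → x ∈β β → x ∈β γ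

partitionOf : List ℕ → List ℕ
partitionOf []       = []
partitionOf (x ∷ xs) = (x ∸ length xs) ∷ partitionOf xs

P : BetaSet → List ℕ
P β = partitionOf (elems β)

data _<P_ : List ℕ → List ℕ → Set where
  []<P  : ∀ {qs} → [] <P qs
  ∷<P   : ∀ {p q ps qs} → p ≤ q → ps <P qs → (p ∷ ps) <P (q ∷ qs)

_≺_ : BetaSet → BetaSet → Set
β ≺ γ = P β <P P γ

Closed : ℕ → ℕ → BetaSet → Set
Closed s t β = ∀ x → x ∈β β →
  (s < x → (x ∸ s) ∈β β) × (t < x → (x ∸ t) ∈β β)

-- Membership in the (s,t)-closure of {n}:
-- x = n - a s - b t  with a, b ≥ 0 and n > a s + b t (i.e. x positive).
InClosureOf : ℕ → ℕ → ℕ → ℕ → Set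
InClosureOf s t n x = 0 < x × ∃ λ a → ∃ λ b → x + a * s + b * t ≡ n

IsDeltaSet : ℕ → ℕ → BetaSet → Set
IsDeltaSet s t Δ = ∃ λ n → 0 < n ×
  (∀ x → (x ∈β Δ → InClosureOf s t n x) × (InClosureOf s t n x → x ∈β Δ))

{-# OPTIONS --safe #-}
module Submission where

open import Defs
open import Data.Nat using (ℕ; zero; suc; _+_; _*_; _∸_; _≤_; _<_; _≤?_; _≟_; _/_; _%_; z≤n; s≤s)
open import Data.Nat.Properties
open import Data.Nat.DivMod using (m≡m%n+[m/n]*n; m%n<n; m<n⇒m%n≡m; [m+kn]%n≡m%n)
open import Data.Nat.Coprimality using (Coprime; coprime-Bézout)
open import Data.Nat.GCD using (module Bézout)
open import Data.Nat.Tactic.RingSolver using (solve-∀)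
open import Data.List using (List; []; _∷_; length; filter)
open import Data.List.Properties using (filter-accept; filter-none; filter-all)
open import Data.List.Relation.Unary.All as All using (All; []; _∷_)
open import Data.List.Relation.Unary.AllPairs using (AllPairs; []; _∷_)
open import Data.List.Relation.Unary.Any using (here; there)
open import Data.List.Relation.Unary.Linked.Properties using (Linked⇒AllPairs)
open import Data.List.Membership.Propositional using (_∈_)
open import Data.List.Membership.DecPropositional _≟_ using (_∈?_)
open import Data.Product using (∃; _×_; _,_; proj₁; proj₂)
open import Data.Sum using (_⊎_; inj₁; inj₂)
open import Data.Unit using (⊤; tt)
open import Function using (case_of_)
open import Relation.Nullary using (¬_; Dec; yes; no; contradiction)
open import Relation.Nullary.Decidable using (_×-dec_; _⊎-dec_; ¬?; decidable-stable) renaming (map′ to mapDec)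
open import Relation.Unary using (Decidable)
open import Relation.Binary.Definitions using (tri<; tri≈; tri>)
open import Relation.Binary.PropositionalEquality using (_≡_; refl; sym; trans; cong; cong₂; subst; module ≡-Reasoning)

-- Put z = n − x, where n generates Δ and d = |Δ| − |β|. Up to this reflection Δ becomes the
-- semigroup S = ⟨s, t⟩, and β, extended by all of S beyond n, an S-ideal J ⊆ S missing d
-- elements of S. The claim becomes that J has at most as many elements below any X as the
-- translate d + S. Compare the numbers of elements in windows [y, y + s): for both sets they
-- are monotone in y; a step of t adds at least one element for J (unless the window is empty or
-- full, by coprimality) but at most one for d + S, whose only elements not in t + (d + S) are
-- d + a s. So once J is ahead of d + S in some window it is never strictly behind
-- in a later one. If J had more elements below X, it would be ahead in some window
-- [X − js, X − js + s) with j > 0, and would keep its surplus forever; but the two counts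
-- agree far out, where J loses d elements to S exactly as the translation by d does.

-- Counting the elements of a decidable set below a bound.

indicator : {A : Set} → Dec A → ℕ
indicator (yes _) = 1
indicator (no _)  = 0

indicator-mono : {A B : Set} (a : Dec A) (b : Dec B) → (A → B) → indicator a ≤ indicator b
indicator-mono (no _)  b        f = z≤n
indicator-mono (yes x) (yes _)  f = ≤-refl
indicator-mono (yes x) (no ¬y)  f = contradiction (f x) ¬y

count : {P : ℕ → Set} → Decidable P → ℕ → ℕ
count P? zero    = 0
count P? (suc k) = count P? k + indicator (P? k)

window : {P : ℕ → Set} → Decidable P → ℕ → ℕ → ℕ
window P? s y = count (λ i → P? (y + i)) s

count-mono : {P Q : ℕ → Set} (P? : Decidable P) (Q? : Decidable Q) → ∀ k →
  (∀ i → i < k → P i → Q i) → count P? k ≤ count Q? k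
count-mono P? Q? zero    f = z≤n
count-mono P? Q? (suc k) f =
  +-mono-≤ (count-mono P? Q? k (λ i i<k → f i (m<n⇒m<1+n i<k)))
           (indicator-mono (P? k) (Q? k) (f k ≤-refl))

count-cong : {P Q : ℕ → Set} (P? : Decidable P) (Q? : Decidable Q) → ∀ k →
  (∀ i → i < k → P i → Q i) → (∀ i → i < k → Q i → P i) → count P? k ≡ count Q? k
count-cong P? Q? k f g = ≤-antisym (count-mono P? Q? k f) (count-mono Q? P? k g)

count-+ : {P : ℕ → Set} (P? : Decidable P) → ∀ y k →
  count P? (y + k) ≡ count P? y + window P? k y
count-+ P? y zero    = trans (cong (count P?) (+-identityʳ y)) (sym (+-identityʳ _))
count-+ P? y (suc k) = trans (cong (count P?) (+-suc y k))
  (trans (cong (_+ indicator (P? (y + k))) (count-+ P? y k)) (+-assoc (count P? y) _ _))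

count-all : {P : ℕ → Set} (P? : Decidable P) → ∀ k → (∀ i → i < k → P i) → count P? k ≡ k
count-all P? zero    f = refl
count-all P? (suc k) f with P? k
... | yes _ = trans (+-comm _ 1) (cong suc (count-all P? k (λ i i<k → f i (m<n⇒m<1+n i<k))))
... | no ¬p = contradiction (f k ≤-refl) ¬p

count-none : {P : ℕ → Set} (P? : Decidable P) → ∀ k → (∀ i → i < k → ¬ P i) → count P? k ≡ 0
count-none P? zero    f = refl
count-none P? (suc k) f with P? k
... | yes p = contradiction p (f k ≤-refl)
... | no _  = trans (+-identityʳ _) (count-none P? k (λ i i<k → f i (m<n⇒m<1+n i<k)))

count≤ : {P : ℕ → Set} (P? : Decidable P) → ∀ k → count P? k ≤ k
count≤ P? k = subst (count P? k ≤_) (count-all {P = λ _ → ⊤} (λ _ → yes tt) k (λ _ _ → tt))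
  (count-mono P? (λ _ → yes tt) k (λ _ _ _ → tt))

-- Turns counts back into membership: an element of `Q` missing from `P` would make the count of `Q`
-- strictly larger. Fullness of a window and invariance of its residues are both obtained this way.
count-converse : {P Q : ℕ → Set} (P? : Decidable P) (Q? : Decidable Q) → ∀ k →
  (∀ i → i < k → P i → Q i) → count Q? k ≤ count P? k → ∀ i → i < k → Q i → P i
count-converse {P} {Q} P? Q? (suc k) f c i i<1+k q with m≤n⇒m<n∨m≡n (m<1+n⇒m≤n i<1+k)
... | inj₁ i<k = count-converse P? Q? k f′
                   (+-cancelʳ-≤ (indicator (P? k)) _ _
                     (≤-trans (+-monoʳ-≤ (count Q? k) (indicator-mono (P? k) (Q? k) (f k ≤-refl))) c))
                   i i<k q
  where
  f′ : ∀ i → i < k → P i → Q i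
  f′ i i<k = f i (m<n⇒m<1+n i<k)
... | inj₂ refl with P? k | Q? k
...   | yes p | _     = p
...   | no _  | no ¬q = contradiction q ¬q
...   | no _  | yes _ = contradiction
          (≤-trans (≤-reflexive (+-comm 1 _)) (≤-trans c (≤-reflexive (+-identityʳ _))))
          (≤⇒≯ (count-mono P? Q? k (λ i i<k → f i (m<n⇒m<1+n i<k))))

count-full : {P : ℕ → Set} (P? : Decidable P) → ∀ k → k ≤ count P? k → ∀ i → i < k → P i
count-full P? k c i i<k = count-converse P? (λ _ → yes tt) k (λ _ _ _ → tt)
  (≤-trans (count≤ (λ _ → yes tt) k) c) i i<k tt

count>0⇒∃ : {P : ℕ → Set} (P? : Decidable P) → ∀ k → 0 < count P? k → ∃ λ i → i < k × P i
count>0⇒∃ P? k c with anyUpTo? P? k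
... | yes w = w
... | no ¬w = contradiction (count-none P? k (λ i i<k p → ¬w (i , i<k , p))) (>⇒≢ c)

∃⇒count>0 : {P : ℕ → Set} (P? : Decidable P) → ∀ k i → i < k → P i → 0 < count P? k
∃⇒count>0 P? k i i<k p = n≢0⇒n>0 λ eq →
  -- With count zero, the set is no larger than the empty one, so it would be contained in it.
  count-converse {P = λ _ → ¬ ⊤} (λ _ → no λ f → f tt) P? k (λ _ _ f → contradiction tt f)
    (≤-trans (≤-reflexive eq) z≤n) i i<k p tt

count<⇒∃¬ : {P : ℕ → Set} (P? : Decidable P) → ∀ k → count P? k < k → ∃ λ i → i < k × ¬ P i
count<⇒∃¬ P? k c with anyUpTo? (λ i → ¬? (P? i)) k
... | yes w = w
... | no ¬w = contradiction
  (count-all P? k (λ i i<k → decidable-stable (P? i) λ ¬p → ¬w (i , i<k , ¬p))) (<⇒≢ c)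

count-≤-+ : {P Q R : ℕ → Set} (P? : Decidable P) (Q? : Decidable Q) (R? : Decidable R) → ∀ k →
  (∀ i → i < k → P i → Q i ⊎ R i) → count P? k ≤ count Q? k + count R? k
count-≤-+ P? Q? R? zero    f = z≤n
count-≤-+ {P} {Q} {R} P? Q? R? (suc k) f = ≤-trans
  (+-mono-≤ (count-≤-+ P? Q? R? k (λ i i<k → f i (m<n⇒m<1+n i<k))) (step (P? k) (Q? k) (R? k)))
  (≤-reflexive (shuffle (count Q? k) (count R? k) _ _))
  where
  shuffle : ∀ a b c d → a + b + (c + d) ≡ a + c + (b + d)
  shuffle = solve-∀
  step : (p : Dec (P k)) (q : Dec (Q k)) (r : Dec (R k)) → indicator p ≤ indicator q + indicator r
  step (no _)  q       r       = z≤n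
  step (yes p) (yes _) r       = s≤s z≤n
  step (yes p) (no _)  (yes _) = ≤-refl
  step (yes p) (no ¬q) (no ¬r) with f k ≤-refl p
  ... | inj₁ q = contradiction q ¬q
  ... | inj₂ r = contradiction r ¬r

count-unique : {P : ℕ → Set} (P? : Decidable P) → ∀ k →
  (∀ i j → i < j → j < k → P i → P j → i ≡ j) → count P? k ≤ 1
count-unique P? zero    u = z≤n
count-unique P? (suc k) u with P? k
... | no _  = ≤-trans (≤-reflexive (+-identityʳ _))
                (count-unique P? k (λ i j i<j j<k → u i j i<j (m<n⇒m<1+n j<k)))
... | yes p = ≤-reflexive (cong (_+ 1) (count-none P? k
                λ i i<k q → <⇒≢ i<k (u i k i<k ≤-refl q p)))

-- Window counts, residues modulo `s`, and growth under `t`.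

-- Sliding a window by one drops `z` and takes in `z + s`, which is present whenever `z` was. The
-- single step splits the count below `z + s + 1` in two ways.
window-mono : {P : ℕ → Set} (P? : Decidable P) → ∀ s → (∀ z → P z → P (z + s)) →
  ∀ y e → window P? s y ≤ window P? s (y + e)
window-mono P? s cl y zero    = ≤-reflexive (cong (window P? s) (sym (+-identityʳ y)))
window-mono P? s cl y (suc e) = ≤-trans (window-mono P? s cl y e)
  (≤-trans (step (y + e)) (≤-reflexive (cong (window P? s) (trans (+-comm _ 1) (sym (+-suc y e))))))
  where
  open ≤-Reasoning
  step : ∀ z → window P? s z ≤ window P? s (z + 1)
  step z = +-cancelˡ-≤ (indicator (P? z)) _ _ (+-cancelˡ-≤ (count P? z) _ _ (begin
    count P? z + (indicator (P? z) + window P? s z)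
      ≡⟨ cong (count P? z +_) (+-comm (indicator (P? z)) _) ⟩
    count P? z + (window P? s z + indicator (P? z))
      ≤⟨ +-monoʳ-≤ (count P? z) (+-monoʳ-≤ (window P? s z)
           (indicator-mono (P? z) (P? (z + s)) (cl z))) ⟩
    count P? z + window P? (suc s) z
      ≡⟨ count-+ P? z (suc s) ⟨
    count P? (z + suc s)
      ≡⟨ cong (count P?) (trans (+-suc z s) (cong (_+ s) (+-comm 1 z))) ⟩
    count P? (z + 1 + s)
      ≡⟨ count-+ P? (z + 1) s ⟩
    count P? (z + 1) + window P? s (z + 1)
      ≡⟨ cong (λ w → count P? w + window P? s (z + 1)) (+-comm z 1) ⟩
    count P? z + indicator (P? z) + window P? s (z + 1)
      ≡⟨ +-assoc (count P? z) _ _ ⟩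
    count P? z + (indicator (P? z) + window P? s (z + 1)) ∎))

residue-unique : ∀ s i j l l′ → i < s → j < s → i + l * s ≡ j + l′ * s → i ≡ j
residue-unique s@(suc _) i j l l′ i<s j<s eq = begin
  i                ≡⟨ m<n⇒m%n≡m i<s ⟨
  i % s            ≡⟨ [m+kn]%n≡m%n i l s ⟨
  (i + l * s) % s  ≡⟨ cong (_% s) eq ⟩
  (j + l′ * s) % s ≡⟨ [m+kn]%n≡m%n j l′ s ⟩
  j % s            ≡⟨ m<n⇒m%n≡m j<s ⟩
  j ∎
  where open ≡-Reasoning

-- Bézout makes `t` invertible modulo `s`, so some `k * t` is congruent to `j - i`. The congruence
-- is written with multiples of `s` on both sides to avoid subtraction.
multiples-cover-residues : ∀ s t → 0 < s → Coprime s t → ∀ i j →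
  ∃ λ k → ∃ λ l → ∃ λ l′ → i + k * t + l * s ≡ j + l′ * s
multiples-cover-residues (suc s) t _ c i j with coprime-Bézout c
-- The modulus is `suc s`, so `i * s` stands for `-i` and `e` for `j - i`. Here `y * t` is congruent
-- to 1.
... | Bézout.-+ x y eq = e * y , 0 , i + e * x , (begin
    i + e * y * t + 0           ≡⟨ reassoc i e y t ⟩
    i + e * (y * t)             ≡⟨ cong (λ w → i + e * w) eq ⟨
    i + e * (1 + x * suc s)     ≡⟨ expand i j s x ⟩
    j + (i + e * x) * suc s     ∎)
  where
  open ≡-Reasoning
  e = j + i * s
  reassoc : ∀ i e y t → i + e * y * t + 0 ≡ i + e * (y * t)
  reassoc = solve-∀
  expand : ∀ i j s x → i + (j + i * s) * (1 + x * suc s) ≡ j + (i + (j + i * s) * x) * suc s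
  expand = solve-∀
-- Now `y * t` is congruent to -1, so `e` stands for `i - j` instead; adding `i` to both sides makes
-- the factor `1 + y * t` appear.
... | Bézout.+- x y eq = e * y , j , e * x , +-cancelˡ-≡ i _ _ (begin
    i + (i + e * y * t + j * suc s) ≡⟨ collect i j s y t ⟩
    i + j + e * (1 + y * t)         ≡⟨ cong (λ w → i + j + e * w) eq ⟩
    i + j + e * (x * suc s)         ≡⟨ reassoc i j e x s ⟩
    i + (j + e * x * suc s)         ∎)
  where
  open ≡-Reasoning
  e = i + j * s
  collect : ∀ i j s y t → i + (i + (i + j * s) * y * t + j * suc s) ≡ i + j + (i + j * s) * (1 + y * t)
  collect = solve-∀
  reassoc : ∀ i j e x s → i + j + e * (x * suc s) ≡ i + (j + e * x * suc s)
  reassoc = solve-∀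

closed-* : {P : ℕ → Set} → ∀ s → (∀ z → P z → P (z + s)) → ∀ l z → P z → P (z + l * s)
closed-* {P} s cl zero    z p = subst P (sym (+-identityʳ z)) p
closed-* {P} s cl (suc l) z p = subst P (+-assoc z s (l * s)) (closed-* s cl l (z + s) (cl z p))

-- If passing from the window at y to the one at y + t gained nothing, the set of
-- residues mod s occupied in it would be invariant under t, hence empty or everything.
window-grows : {P : ℕ → Set} (P? : Decidable P) → ∀ s t → 0 < s → Coprime s t →
  (∀ z → P z → P (z + s)) → (∀ z → P z → P (z + t)) →
  ∀ y → 0 < window P? s y → window P? s y < s → window P? s y < window P? s (y + t)
window-grows {P} P? s@(suc _) t s>0 cop cls clt y w>0 w<s =
  ≰⇒> λ le → absurd (count-converse (λ i → P? (y + i)) (λ i → P? (y + t + i)) s shift le)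
  where
  shift : ∀ i → i < s → P (y + i) → P (y + t + i)
  shift i _ p = subst P (swap y i t) (clt (y + i) p)
    where
    swap : ∀ y i t → y + i + t ≡ y + t + i
    swap = solve-∀

  -- The whole orbit of a missing residue under `t` is missing: if the residue of `j + t` were
  -- present, closure under `s` would give `y + t + j`, and `back` would give `y + j`.
  absent : (∀ i → i < s → P (y + t + i) → P (y + i)) → ∀ i → i < s → ¬ P (y + i) →
    ∀ k → ∃ λ j → ∃ λ l → j < s × i + k * t ≡ j + l * s × ¬ P (y + j)
  absent back i i<s ¬p zero = i , 0 , i<s , refl , ¬p
  absent back i i<s ¬p (suc k) with absent back i i<s ¬p k
  ... | j , l , j<s , eq , ¬q = (j + t) % s , (j + t) / s + l , m%n<n (j + t) s , eq′ ,
    λ q → ¬q (back j j<s (subst P wrapped (closed-* s cls ((j + t) / s) _ q)))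
    where
    open ≡-Reasoning
    wrapped : y + (j + t) % s + (j + t) / s * s ≡ y + t + j
    wrapped = begin
      y + (j + t) % s + (j + t) / s * s   ≡⟨ +-assoc y _ _ ⟩
      y + ((j + t) % s + (j + t) / s * s) ≡⟨ cong (y +_) (m≡m%n+[m/n]*n (j + t) s) ⟨
      y + (j + t)                         ≡⟨ cong (y +_) (+-comm j t) ⟩
      y + (t + j)                         ≡⟨ +-assoc y t j ⟨
      y + t + j                           ∎
    pull : ∀ i t kt → i + (t + kt) ≡ i + kt + t
    pull = solve-∀
    merge : ∀ r q l s → r + q * s + l * s ≡ r + (q + l) * s
    merge = solve-∀
    swap : ∀ j l t → j + l + t ≡ j + t + l
    swap = solve-∀
    eq′ : i + suc k * t ≡ (j + t) % s + ((j + t) / s + l) * s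
    eq′ = begin
      i + (t + k * t)                     ≡⟨ pull i t (k * t) ⟩
      i + k * t + t                       ≡⟨ cong (_+ t) eq ⟩
      j + l * s + t                       ≡⟨ swap j (l * s) t ⟩
      j + t + l * s                       ≡⟨ cong (_+ l * s) (m≡m%n+[m/n]*n (j + t) s) ⟩
      (j + t) % s + (j + t) / s * s + l * s ≡⟨ merge _ ((j + t) / s) l s ⟩
      (j + t) % s + ((j + t) / s + l) * s ∎

  absurd : ¬ (∀ i → i < s → P (y + t + i) → P (y + i))
  -- By coprimality the orbit of the missing residue `i` reaches the occupied residue `j`.
  absurd back with count>0⇒∃ (λ i → P? (y + i)) s w>0 | count<⇒∃¬ (λ i → P? (y + i)) s w<s
  ... | j , j<s , p | i , i<s , ¬p with multiples-cover-residues s t s>0 cop i j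
  ... | k , l , l′ , eq with absent back i i<s ¬p k
  ... | j′ , l″ , j′<s , eq′ , ¬q = ¬q (subst (λ w → P (y + w)) (sym same) p)
    where
    merge : ∀ j a b s → j + (a + b) * s ≡ j + a * s + b * s
    merge = solve-∀
    same : j′ ≡ j
    same = residue-unique s j′ j (l″ + l) l′ j′<s j<s
      (trans (merge j′ l″ l s) (trans (cong (_+ l * s) (sym eq′)) eq))

-- Repeated steps of `t` and the comparison of two sets.

step-suc : ∀ y e s → y + e * s + s ≡ y + suc e * s
step-suc y e s = trans (+-assoc y _ s) (cong (y +_) (+-comm (e * s) s))

-- Iterates `window-grows`. The strict bound `p <` keeps the window nonempty at each step, and a
-- full window stays full by closure under `t`.
window-saturates : {P : ℕ → Set} (P? : Decidable P) → ∀ s t → 0 < s → Coprime s t →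
  (∀ z → P z → P (z + s)) → (∀ z → P z → P (z + t)) →
  ∀ p y → p < window P? s y →
  ∀ e → p + e < window P? s (y + e * t) ⊎ s ≤ window P? s (y + e * t)
window-saturates {P} P? s t s>0 cop cls clt p y p<w = go
  where
  w = window P? s

  w-shift : ∀ z → w z ≤ w (z + t)
  w-shift z = count-mono (λ i → P? (z + i)) (λ i → P? (z + t + i)) s
    λ i _ q → subst P (swap z i) (clt (z + i) q)
    where
    swap : ∀ z i → z + i + t ≡ z + t + i
    swap z i = trans (+-assoc z i t) (trans (cong (z +_) (+-comm i t)) (sym (+-assoc z t i)))

  go : ∀ e → p + e < w (y + e * t) ⊎ s ≤ w (y + e * t)
  go zero = inj₁ (subst (λ x → p + 0 < w x) (sym (+-identityʳ y))
                   (subst (_< w y) (sym (+-identityʳ p)) p<w))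
  go (suc e) rewrite sym (step-suc y e t) with s ≤? w (y + e * t) | go e
  ... | yes full | _         = inj₂ (≤-trans full (w-shift (y + e * t)))
  ... | no ¬full | inj₂ full = contradiction full ¬full
  ... | no ¬full | inj₁ lt   = inj₁ (≤-<-trans (≤-trans (≤-reflexive (+-suc p e)) lt)
    (window-grows P? s t s>0 cop cls clt (y + e * t) (≤-<-trans z≤n lt) (≰⇒> ¬full)))

-- A crossing would bring the window counts of P back below those of Q, whereas along
-- steps of t the former gain at least one (until saturated) and the latter at most one.
window-≤-after-crossing : {P Q : ℕ → Set} (P? : Decidable P) (Q? : Decidable Q) →
  ∀ s t → 0 < s → Coprime s t →
  (∀ z → P z → P (z + s)) → (∀ z → P z → P (z + t)) → (∀ z → Q z → Q (z + s)) →
  (∀ y → window Q? s (y + t) ≤ suc (window Q? s y)) →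
  ∀ y → window Q? s y < window P? s y → ∀ e → window Q? s (y + e) ≤ window P? s (y + e)
window-≤-after-crossing P? Q? s t s>0 cop cls clt clsQ slow y cross e = ≮⇒≥ absurd
  where
  wP = window P? s
  wQ = window Q? s

  fast : ∀ e → wQ y + e < wP (y + e * t) ⊎ s ≤ wP (y + e * t)
  fast = window-saturates P? s t s>0 cop cls clt (wQ y) y cross

  slow* : ∀ e → wQ (y + e * t) ≤ wQ y + e
  slow* zero    = ≤-reflexive (trans (cong wQ (+-identityʳ y)) (sym (+-identityʳ (wQ y))))
  slow* (suc e) = ≤-trans (≤-reflexive (cong wQ (sym (step-suc y e t))))
    (≤-trans (slow (y + e * t)) (≤-trans (s≤s (slow* e)) (≤-reflexive (sym (+-suc (wQ y) e)))))

  absurd : ¬ wP (y + e) < wQ (y + e)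
  absurd lt = <⇒≱ lt (≤-trans wQ≤ (≤-trans (slow* d) (≤-reflexive wQ+d)))
    where
    q = wP (y + e)
    -- After `d` steps of `t`, `P` exceeds `q`, so by monotonicity `y + e` is no later than
    -- `y + d * t`. By then `Q` has reached at most `wQ y + d`, which is `q`.
    d = q ∸ wQ y
    wQ+d : wQ y + d ≡ q
    wQ+d = m+[n∸m]≡n (≤-trans (<⇒≤ cross) (window-mono P? s cls y e))
    above : q < wP (y + d * t)
    above with fast d
    ... | inj₁ l    = subst (_< wP (y + d * t)) wQ+d l
    ... | inj₂ full = <-≤-trans lt (≤-trans (count≤ _ s) full)
    e≤dt : e ≤ d * t
    e≤dt = ≮⇒≥ λ dt<e → <⇒≱ above (subst (λ w → wP (y + d * t) ≤ wP w)
      (trans (+-assoc y _ _) (cong (y +_) (m+[n∸m]≡n (<⇒≤ dt<e))))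
      (window-mono P? s cls (y + d * t) (e ∸ d * t)))
    wQ≤ : wQ (y + e) ≤ wQ (y + d * t)
    wQ≤ = subst (λ w → wQ (y + e) ≤ wQ w)
      (trans (+-assoc y _ _) (cong (y +_) (m+[n∸m]≡n e≤dt)))
      (window-mono Q? s clsQ (y + e) (d * t ∸ e))

-- Cut the numbers below `X` into a remainder shorter than `s` and windows of length `s`. As `P` has
-- nothing in the remainder, a surplus of `P` puts it ahead in some window, and the later windows
-- preserve the surplus, against `eventually`.
count-domination : {P Q : ℕ → Set} (P? : Decidable P) (Q? : Decidable Q) →
  ∀ s t → 0 < s → Coprime s t →
  (∀ z → P z → P (z + s)) → (∀ z → P z → P (z + t)) → (∀ z → Q z → Q (z + s)) →
  (∀ y → window Q? s (y + t) ≤ suc (window Q? s y)) →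
  (∀ z → z < s → ¬ P z) →
  ∀ Y → (∀ Z → Y ≤ Z → count P? Z ≤ count Q? Z) → ∀ X → count P? X ≤ count Q? X
count-domination P? Q? s@(suc _) t s>0 cop cls clt clsQ slow low Y eventually X =
  ≮⇒≥ λ lt → <⇒≱ (persist lt Y)
    (eventually (X + Y * s) (≤-trans (m≤m*n Y s) (m≤n+m (Y * s) X)))
  where
  crossing : ∀ q r → r < s → count Q? (r + q * s) < count P? (r + q * s) →
    ∃ λ y → ∃ λ e → y + e ≡ r + q * s × window Q? s y < window P? s y
  crossing zero r r<s lt = contradiction
    (subst (count Q? (r + 0) <_) (trans (cong (count P?) (+-identityʳ r))
      (count-none P? r λ i i<r → low i (<-trans i<r r<s))) lt) n≮0
  crossing (suc q) r r<s lt with window P? s (r + q * s) ≤? window Q? s (r + q * s)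
  ... | no ≰  = r + q * s , s , step-suc r q s , ≰⇒> ≰
  ... | yes ≤w with crossing q r r<s (+-cancelʳ-< (window P? s (r + q * s)) _ _ (begin-strict
            count Q? (r + q * s) + window P? s (r + q * s) ≤⟨ +-monoʳ-≤ (count Q? (r + q * s)) ≤w ⟩
            count Q? (r + q * s) + window Q? s (r + q * s) ≡⟨ count-+ Q? (r + q * s) s ⟨
            count Q? (r + q * s + s)                       ≡⟨ cong (count Q?) (step-suc r q s) ⟩
            count Q? (r + suc q * s)                       <⟨ lt ⟩
            count P? (r + suc q * s)                       ≡⟨ cong (count P?) (step-suc r q s) ⟨
            count P? (r + q * s + s)                       ≡⟨ count-+ P? (r + q * s) s ⟩
            count P? (r + q * s) + window P? s (r + q * s) ∎))
    where
    open ≤-Reasoning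
  ...   | y , e , eq , w = y , e + s , trans (sym (+-assoc y e s))
            (trans (cong (_+ s) eq) (step-suc r q s)) , w

  persist : count Q? X < count P? X → ∀ L → count Q? (X + L * s) < count P? (X + L * s)
  persist lt L with crossing (X / s) (X % s) (m%n<n X s)
                      (subst (λ w → count Q? w < count P? w) (m≡m%n+[m/n]*n X s) lt)
  ... | y , e , eq , w = go L
    where
    open ≤-Reasoning
    go : ∀ L → count Q? (X + L * s) < count P? (X + L * s)
    go zero    = subst (λ w → count Q? w < count P? w) (sym (+-identityʳ X)) lt
    go (suc L) = begin-strict
      count Q? (X + suc L * s)                     ≡⟨ cong (count Q?) (step-suc X L s) ⟨
      count Q? (X + L * s + s)                     ≡⟨ count-+ Q? (X + L * s) s ⟩
      count Q? (X + L * s) + window Q? s (X + L * s) <⟨ +-mono-<-≤ (go L) ahead ⟩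
      count P? (X + L * s) + window P? s (X + L * s) ≡⟨ count-+ P? (X + L * s) s ⟨
      count P? (X + L * s + s)                     ≡⟨ cong (count P?) (step-suc X L s) ⟩
      count P? (X + suc L * s)                     ∎
      where
      ahead : window Q? s (X + L * s) ≤ window P? s (X + L * s)
      ahead = subst (λ w → window Q? s w ≤ window P? s w)
        (trans (sym (+-assoc y e (L * s)))
               (cong (_+ L * s) (trans eq (sym (m≡m%n+[m/n]*n X s)))))
        (window-≤-after-crossing P? Q? s t s>0 cop cls clt clsQ slow y w (e + L * s))

-- Translates of the numerical semigroup generated by `s` and `t`.

InCone : ℕ → ℕ → ℕ → ℕ → Set
InCone s t g z = ∃ λ a → ∃ λ b → g + a * s + b * t ≡ z

-- Since `s` and `t` are positive, neither coefficient exceeds `z`, and a bounded search decides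
-- membership.
inCone? : ∀ s t → 0 < s → 0 < t → ∀ g → Decidable (InCone s t g)
inCone? s@(suc _) t@(suc _) _ _ g z = mapDec
  (λ { (a , _ , b , _ , eq) → a , b , eq })
  (λ { (a , b , refl) → a , bound-a a b , b , bound-b a b , refl })
  (anyUpTo? (λ a → anyUpTo? (λ b → g + a * s + b * t ≟ z) (suc z)) (suc z))
  where
  bound-a : ∀ a b → a < suc (g + a * s + b * t)
  bound-a a b = s≤s (≤-trans (m≤m*n a s) (≤-trans (m≤n+m _ g) (m≤m+n _ _)))
  bound-b : ∀ a b → b < suc (g + a * s + b * t)
  bound-b a b = s≤s (≤-trans (m≤m*n b t) (m≤n+m _ _))

cone-+s : ∀ s t g z → InCone s t g z → InCone s t g (z + s)
cone-+s s t g z (a , b , refl) = suc a , b , eq g a b s t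
  where
  eq : ∀ g a b s t → g + suc a * s + b * t ≡ g + a * s + b * t + s
  eq = solve-∀

cone-+t : ∀ s t g z → InCone s t g z → InCone s t g (z + t)
cone-+t s t g z (a , b , refl) = a , suc b , eq g a b s t
  where
  eq : ∀ g a b s t → g + a * s + suc b * t ≡ g + a * s + b * t + t
  eq = solve-∀

cone-≥ : ∀ s t g z → InCone s t g z → g ≤ z
cone-≥ s t g z (a , b , refl) = ≤-trans (m≤m+n g _) (m≤m+n _ _)

cone-shift : ∀ s t g d z → InCone s t g z → InCone s t (g + d) (d + z)
cone-shift s t g d z (a , b , refl) = a , b , eq g d (a * s) (b * t)
  where
  eq : ∀ g d u v → g + d + u + v ≡ d + (g + u + v)
  eq = solve-∀

cone-unshift : ∀ s t g d z → InCone s t (g + d) (d + z) → InCone s t g z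
cone-unshift s t g d z (a , b , e) = a , b , +-cancelˡ-≡ d _ _ (trans (eq g d (a * s) (b * t)) e)
  where
  eq : ∀ g d u v → d + (g + u + v) ≡ g + d + u + v
  eq = solve-∀

-- An element gained by the step cannot use `t`, or removing one `t` would place it in the old
-- window. So it has the form `g + a * s`, and a window of length `s` contains at most one number of
-- that residue.
cone-window-slow : ∀ s t (s>0 : 0 < s) (t>0 : 0 < t) g y →
  window (inCone? s t s>0 t>0 g) s (y + t) ≤ suc (window (inCone? s t s>0 t>0 g) s y)
cone-window-slow s t s>0 t>0 g y = ≤-trans
  (count-≤-+ (λ i → K? (y + t + i)) (λ i → K? (y + i)) new? s split)
  (≤-trans (+-monoʳ-≤ (window K? s y) (count-unique new? s unique)) (≤-reflexive (+-comm _ 1)))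
  where
  K  = InCone s t g
  K? = inCone? s t s>0 t>0 g

  New : ℕ → Set
  New i = K (y + t + i) × ¬ K (y + i)

  new? : Decidable New
  new? i = K? (y + t + i) ×-dec ¬? (K? (y + i))

  split : ∀ i → i < s → K (y + t + i) → K (y + i) ⊎ New i
  split i _ k with K? (y + i)
  ... | yes k′ = inj₁ k′
  ... | no ¬k′ = inj₂ (k , ¬k′)

  multiple : ∀ i → New i → ∃ λ a → g + a * s ≡ y + t + i
  multiple i ((a , zero , eq) , _) = a , trans (sym (+-identityʳ _)) eq
  multiple i ((a , suc b , eq) , ¬k) = contradiction
    (a , b , +-cancelˡ-≡ t _ _ (trans (move t (g + a * s) (b * t)) (trans eq (swap y t i)))) ¬k
    where
    move : ∀ t u v → t + (u + v) ≡ u + (t + v)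
    move = solve-∀
    swap : ∀ y t i → y + t + i ≡ t + (y + i)
    swap = solve-∀

  unique : ∀ i j → i < j → j < s → New i → New j → i ≡ j
  unique i j i<j j<s ni nj with multiple i ni | multiple j nj
  ... | a , eq | a′ , eq′ = residue-unique s i j a′ a (<-trans i<j j<s) j<s
    (+-cancelˡ-≡ (y + t) _ _ (begin
      y + t + (i + a′ * s)   ≡⟨ +-assoc (y + t) i _ ⟨
      y + t + i + a′ * s     ≡⟨ cong (_+ a′ * s) eq ⟨
      g + a * s + a′ * s     ≡⟨ swap g (a * s) (a′ * s) ⟩
      g + a′ * s + a * s     ≡⟨ cong (_+ a * s) eq′ ⟩
      y + t + j + a * s      ≡⟨ +-assoc (y + t) j _ ⟩
      y + t + (j + a * s)    ∎))
    where
    open ≡-Reasoning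
    swap : ∀ g u v → g + u + v ≡ g + v + u
    swap = solve-∀

-- The window at `g` contains `g`, so `s` steps of `t` fill it; by monotonicity all windows from
-- `g + s * t` on are full.
cone-cofinite : ∀ s t → 0 < s → 0 < t → Coprime s t → ∀ g → ∃ λ Y → ∀ z → Y ≤ z → InCone s t g z
cone-cofinite s t s>0 t>0 cop g = g + s * t , λ z Y≤z →
  subst K (trans (+-identityʳ _) (m+[n∸m]≡n Y≤z))
    (count-full (λ i → K? (g + s * t + (z ∸ (g + s * t)) + i)) s
      (≤-trans filled (window-mono K? s cls (g + s * t) (z ∸ (g + s * t)))) 0 s>0)
  where
  K   = InCone s t g
  K?  = inCone? s t s>0 t>0 g
  cls = cone-+s s t g
  clt = cone-+t s t g

  filled : s ≤ window K? s (g + s * t)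
  filled with window-saturates K? s t s>0 cop cls clt 0 g
                (∃⇒count>0 (λ i → K? (g + i)) s 0 s>0 (0 , 0 , +-identityʳ (g + 0))) s
  ... | inj₁ s<w = <⇒≤ s<w
  ... | inj₂ s≤w = s≤w

cone-count-shift : ∀ s t (s>0 : 0 < s) (t>0 : 0 < t) g d k →
  count (inCone? s t s>0 t>0 (g + d)) (d + k) ≡ count (inCone? s t s>0 t>0 g) k
cone-count-shift s t s>0 t>0 g d k = begin
  count Q? (d + k)             ≡⟨ count-+ Q? d k ⟩
  count Q? d + window Q? k d   ≡⟨ cong (_+ window Q? k d) (count-none Q? d below) ⟩
  window Q? k d                ≡⟨ count-cong (λ i → Q? (d + i)) K? k
                                    (λ i _ → cone-unshift s t g d i) (λ i _ → cone-shift s t g d i) ⟩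
  count K? k                   ∎
  where
  open ≡-Reasoning
  K? = inCone? s t s>0 t>0 g
  Q? = inCone? s t s>0 t>0 (g + d)
  below : ∀ i → i < d → ¬ InCone s t (g + d) i
  below i i<d q = <⇒≱ i<d (≤-trans (m≤n+m d g) (cone-≥ s t (g + d) i q))

-- Decreasing lists, threshold counts and partitions.

Decreasing : List ℕ → Set
Decreasing = AllPairs (λ x y → y < x)

atLeast : ℕ → List ℕ → ℕ
atLeast x l = length (filter (x ≤?_) l)

atLeast-none : ∀ {x l} → All (_< x) l → atLeast x l ≡ 0
atLeast-none {x} a = cong length (filter-none (x ≤?_) (All.map <⇒≱ a))

atLeast-all : ∀ {x l} → All (x ≤_) l → atLeast x l ≡ length l
atLeast-all {x} a = cong length (filter-all (x ≤?_) a)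

atLeast-accept : ∀ {x y} l → x ≤ y → atLeast x (y ∷ l) ≡ suc (atLeast x l)
atLeast-accept {x} l x≤y = cong length (filter-accept (x ≤?_) x≤y)


-- Strict decrease lets `x` occur at most once, so a single indicator accounts for the difference.
atLeast-suc : ∀ x {l} → Decreasing l → atLeast x l ≡ atLeast (suc x) l + indicator (x ∈? l)
atLeast-suc x [] = refl
atLeast-suc x {y ∷ l} (y>l ∷ dec) with <-cmp x y
... | tri< x<y x≢y _ = begin
  atLeast x (y ∷ l)                           ≡⟨ atLeast-accept l (<⇒≤ x<y) ⟩
  suc (atLeast x l)                           ≡⟨ cong suc (atLeast-suc x dec) ⟩
  suc (atLeast (suc x) l) + indicator (x ∈? l) ≡⟨ cong₂ _+_ (sym (atLeast-accept l x<y)) same ⟩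
  atLeast (suc x) (y ∷ l) + indicator (x ∈? (y ∷ l)) ∎
  where
  open ≡-Reasoning
  same : indicator (x ∈? l) ≡ indicator (x ∈? (y ∷ l))
  same = ≤-antisym (indicator-mono (x ∈? l) (x ∈? (y ∷ l)) there)
    (indicator-mono (x ∈? (y ∷ l)) (x ∈? l)
      λ { (here eq) → contradiction eq x≢y ; (there i) → i })
... | tri≈ _ refl _ = begin
  atLeast x (x ∷ l)         ≡⟨ atLeast-accept l ≤-refl ⟩
  suc (atLeast x l)         ≡⟨ cong suc (atLeast-none y>l) ⟩
  1                         ≡⟨ cong₂ _+_ (atLeast-none {suc x} {x ∷ l} (≤-refl ∷ All.map m<n⇒m<1+n y>l)) present ⟨
  atLeast (suc x) (x ∷ l) + indicator (x ∈? (x ∷ l)) ∎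
  where
  open ≡-Reasoning
  present : indicator (x ∈? (x ∷ l)) ≡ 1
  present with x ∈? (x ∷ l)
  ... | yes _ = refl
  ... | no ∉  = contradiction (here refl) ∉
... | tri> _ _ y<x = trans (atLeast-none below)
  (sym (cong₂ _+_ (atLeast-none (All.map m<n⇒m<1+n below)) missing))
  where
  below : All (_< x) (y ∷ l)
  below = y<x ∷ All.map (λ z<y → <-trans z<y y<x) y>l
  missing : indicator (x ∈? (y ∷ l)) ≡ 0
  missing with x ∈? (y ∷ l)
  ... | yes ∈l = contradiction (All.lookup below ∈l) (<-irrefl refl)
  ... | no _   = refl

-- The reflection of `z` to `m ∸ z` carries the numbers below `k` to those from `suc m ∸ k` to `m`,
-- and `bound` excludes entries beyond `m`.
count≡atLeast : ∀ {P : ℕ → Set} (P? : Decidable P) m {l} → Decreasing l → All (_< suc m) l →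
  (∀ z → z < m → P z → m ∸ z ∈ l) → (∀ z → z < m → m ∸ z ∈ l → P z) →
  ∀ k → k ≤ m → count P? k ≡ atLeast (suc m ∸ k) l
count≡atLeast P? m dec bound to from zero _ = sym (atLeast-none bound)
count≡atLeast P? m {l} dec bound to from (suc k) k<m = begin
  count P? k + indicator (P? k)
    ≡⟨ cong₂ _+_ (count≡atLeast P? m dec bound to from k (<⇒≤ k<m))
         (≤-antisym (indicator-mono (P? k) (m ∸ k ∈? l) (to k k<m))
                    (indicator-mono (m ∸ k ∈? l) (P? k) (from k k<m))) ⟩
  atLeast (suc m ∸ k) l + indicator (m ∸ k ∈? l)
    ≡⟨ cong (λ w → atLeast w l + indicator (m ∸ k ∈? l)) (+-∸-assoc 1 (<⇒≤ k<m)) ⟩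
  atLeast (suc (m ∸ k)) l + indicator (m ∸ k ∈? l)
    ≡⟨ atLeast-suc (m ∸ k) dec ⟨
  atLeast (m ∸ k) l ∎
  where open ≡-Reasoning

-- Entries in the same position are reduced by amounts differing by `d`, the difference in length.
-- It therefore suffices that each entry of `qs` exceeds its partner in `ps` by at least `d`, which
-- the threshold counts give position by position.
partitionOf-mono : ∀ d {ps qs} → Decreasing ps → All (0 <_) ps → Decreasing qs →
  length qs ≡ length ps + d →
  (∀ x → 0 < x → atLeast x ps ≤ atLeast (x + d) qs) → partitionOf ps <P partitionOf qs
partitionOf-mono d {[]} _ _ _ _ _ = []<P
partitionOf-mono d {x ∷ xs} {y ∷ ys} (x>xs ∷ decx) (x>0 ∷ xs>0) (y>ys ∷ decy) len dom =
  ∷<P head (partitionOf-mono d decx xs>0 decy len′ tail)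
  where
  len′ : length ys ≡ length xs + d
  len′ = suc-injective len

  x+d≤y : x + d ≤ y
  x+d≤y = ≮⇒≥ λ y<x+d → <⇒≱ {0} (s≤s z≤n) (begin
    suc (atLeast x xs)       ≡⟨ atLeast-accept xs ≤-refl ⟨
    atLeast x (x ∷ xs)       ≤⟨ dom x x>0 ⟩
    atLeast (x + d) (y ∷ ys) ≡⟨ atLeast-none (y<x+d ∷ All.map (λ z<y → <-trans z<y y<x+d) y>ys) ⟩
    0                        ∎)
    where open ≤-Reasoning

  head : x ∸ length xs ≤ y ∸ length ys
  head = begin
    x ∸ length xs             ≡⟨ [m+n]∸[m+o]≡n∸o d x (length xs) ⟨
    (d + x) ∸ (d + length xs) ≡⟨ cong₂ _∸_ (+-comm d x) (trans (+-comm d _) (sym len′)) ⟩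
    (x + d) ∸ length ys       ≤⟨ ∸-monoˡ-≤ (length ys) x+d≤y ⟩
    y ∸ length ys             ∎
    where open ≤-Reasoning

  -- For `z` up to `x` both heads are counted and cancel; above `x` nothing in `xs` is counted.
  tail : ∀ z → 0 < z → atLeast z xs ≤ atLeast (z + d) ys
  tail z z>0 with z ≤? x
  ... | no z≰x  = ≤-trans (≤-reflexive (atLeast-none
                    (All.map (λ w<x → <-trans w<x (≰⇒> z≰x)) x>xs))) z≤n
  ... | yes z≤x = ≤-pred (begin
    suc (atLeast z xs)       ≡⟨ atLeast-accept xs z≤x ⟨
    atLeast z (x ∷ xs)       ≤⟨ dom z z>0 ⟩
    atLeast (z + d) (y ∷ ys) ≡⟨ atLeast-accept ys (≤-trans (+-monoˡ-≤ d z≤x) x+d≤y) ⟩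
    suc (atLeast (z + d) ys) ∎)
    where open ≤-Reasoning

-- Reflecting both beta-sets and comparing with the translated semigroup.

theorem3p2 : (s t : ℕ) → 0 < s → s < t → Coprime s t →
    (Δ β : BetaSet) → IsDeltaSet s t Δ → Closed s t Δ → Closed s t β →
    β ⊆β Δ → β ≺ Δ
theorem3p2 s t s>0 s<t cop Δ β (n , _ , generated) _ closedβ β⊆Δ =
  partitionOf-mono d decβ (positive β) decΔ lengthΔ dominated
  where
  t>0 : 0 < t
  t>0 = <-trans s>0 s<t

  -- An element x of Δ is recorded as z = m ∸ x; the offset s keeps the first window empty.
  m : ℕ
  m = n + s

  K J : ℕ → Set
  K = InCone s t s
  -- Subtracting `s` or `t` within `β` is only possible while the result is positive; admitting all
  -- of `K` from `m` on makes `J` closed under addition without exception.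
  J z = K z × (m ≤ z ⊎ m ∸ z ∈ elems β)

  K? : Decidable K
  K? = inCone? s t s>0 t>0 s

  J? : Decidable J
  J? z = K? z ×-dec (m ≤? z ⊎-dec m ∸ z ∈? elems β)

  decΔ : Decreasing (elems Δ)
  decΔ = Linked⇒AllPairs (λ y<x z<y → <-trans z<y y<x) (decr Δ)

  decβ : Decreasing (elems β)
  decβ = Linked⇒AllPairs (λ y<x z<y → <-trans z<y y<x) (decr β)

  swap : ∀ r u v → r + (s + u + v) ≡ r + u + v + s
  swap r u v = trans (cong (r +_) (trans (+-assoc s u v) (+-comm s (u + v))))
    (trans (sym (+-assoc r (u + v) s)) (cong (_+ s) (sym (+-assoc r u v))))

  K⇒Δ : ∀ z → z < m → K z → m ∸ z ∈ elems Δ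
  K⇒Δ z z<m (a , b , eq) = proj₂ (generated (m ∸ z)) (m<n⇒0<n∸m z<m , a , b ,
    +-cancelʳ-≡ s _ _ (trans (sym (swap (m ∸ z) (a * s) (b * t)))
      (trans (cong (m ∸ z +_) eq) (m∸n+n≡m (<⇒≤ z<m)))))

  Δ⇒K : ∀ z → z < m → m ∸ z ∈ elems Δ → K z
  Δ⇒K z z<m x∈ with proj₁ (generated (m ∸ z)) x∈
  ... | _ , a , b , eq = a , b , +-cancelˡ-≡ (m ∸ z) _ _
    (trans (swap (m ∸ z) (a * s) (b * t)) (trans (cong (_+ s) eq) (sym (m∸n+n≡m (<⇒≤ z<m)))))

  J⇒β : ∀ z → z < m → J z → m ∸ z ∈ elems β
  J⇒β z z<m (_ , inj₁ m≤z) = contradiction m≤z (<⇒≱ z<m)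
  J⇒β z z<m (_ , inj₂ x∈)  = x∈

  β⇒J : ∀ z → z < m → m ∸ z ∈ elems β → J z
  β⇒J z z<m x∈ = Δ⇒K z z<m (β⊆Δ _ x∈) , inj₂ x∈

  J-closed : ∀ u → (∀ z → K z → K (z + u)) →
    (∀ x → x ∈ elems β → u < x → x ∸ u ∈ elems β) → ∀ z → J z → J (z + u)
  J-closed u clK clβ z (k , inj₁ m≤z) = clK z k , inj₁ (≤-trans m≤z (m≤m+n z u))
  J-closed u clK clβ z (k , inj₂ x∈) with m ≤? z + u
  ... | yes m≤ = clK z k , inj₁ m≤
  ... | no m≰  = clK z k , inj₂ (subst (_∈ elems β) (∸-+-assoc m z u)
    (clβ (m ∸ z) x∈ (m+n≤o⇒m≤o∸n (suc u) (≤-trans (≤-reflexive (cong suc (+-comm u z))) (≰⇒> m≰)))))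

  Δ<1+m : All (_< suc m) (elems Δ)
  Δ<1+m = All.tabulate λ {x} x∈ → case proj₁ (generated x) x∈ of λ
    { (_ , a , b , eq) → s≤s (≤-trans (≤-trans (m≤m+n x (a * s)) (≤-trans (m≤m+n _ (b * t))
        (≤-reflexive eq))) (m≤m+n n s)) }

  β<1+m : All (_< suc m) (elems β)
  β<1+m = All.tabulate λ {x} x∈ → All.lookup Δ<1+m (β⊆Δ x x∈)

  countK : ∀ k → k ≤ m → count K? k ≡ atLeast (suc m ∸ k) (elems Δ)
  countK = count≡atLeast K? m decΔ Δ<1+m K⇒Δ Δ⇒K

  countJ : ∀ k → k ≤ m → count J? k ≡ atLeast (suc m ∸ k) (elems β)
  countJ = count≡atLeast J? m decβ β<1+m J⇒β β⇒J

  1+m∸m : suc m ∸ m ≡ 1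
  1+m∸m = m+n∸n≡m 1 m

  countK-m : count K? m ≡ length (elems Δ)
  countK-m = trans (countK m ≤-refl)
    (trans (cong (λ w → atLeast w (elems Δ)) 1+m∸m) (atLeast-all (positive Δ)))

  countJ-m : count J? m ≡ length (elems β)
  countJ-m = trans (countJ m ≤-refl)
    (trans (cong (λ w → atLeast w (elems β)) 1+m∸m) (atLeast-all (positive β)))

  d : ℕ
  d = length (elems Δ) ∸ length (elems β)

  lengthΔ : length (elems Δ) ≡ length (elems β) + d
  lengthΔ = sym (m+[n∸m]≡n (subst (_≤ length (elems Δ)) countJ-m
    (subst (count J? m ≤_) countK-m (count-mono J? K? m λ _ _ → proj₁))))

  Q? : Decidable (InCone s t (s + d))
  Q? = inCone? s t s>0 t>0 (s + d)

  -- From `m` on the two sets coincide, so the deficit `d` reached at `m` is permanent.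
  countK≡countJ+d : ∀ e → count K? (m + e) ≡ count J? (m + e) + d
  countK≡countJ+d e = begin
    count K? (m + e)                          ≡⟨ count-+ K? m e ⟩
    count K? m + window K? e m                ≡⟨ cong₂ _+_ (trans countK-m lengthΔ)
      (count-cong (λ i → K? (m + i)) (λ i → J? (m + i)) e
        (λ i _ k → k , inj₁ (m≤m+n m i)) (λ _ _ → proj₁)) ⟩
    length (elems β) + d + window J? e m      ≡⟨ +-assoc (length (elems β)) d _ ⟩
    length (elems β) + (d + window J? e m)    ≡⟨ cong₂ _+_ countJ-m (+-comm (window J? e m) d) ⟨
    count J? m + (window J? e m + d)          ≡⟨ +-assoc (count J? m) _ d ⟨
    count J? m + window J? e m + d            ≡⟨ cong (_+ d) (count-+ J? m e) ⟨
    count J? (m + e) + d                      ∎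
    where open ≡-Reasoning

  countJ≤countQ : ∀ X → count J? X ≤ count Q? X
  countJ≤countQ with cone-cofinite s t s>0 t>0 cop s
  ... | Y , full = count-domination J? Q? s t s>0 cop
    (J-closed s (cone-+s s t s) λ x x∈ → proj₁ (closedβ x x∈))
    (J-closed t (cone-+t s t s) λ x x∈ → proj₂ (closedβ x x∈))
    (cone-+s s t (s + d)) (cone-window-slow s t s>0 t>0 (s + d))
    (λ z z<s j → <⇒≱ z<s (cone-≥ s t s z (proj₁ j)))
    (m + Y + d) eventually
    where
    open ≤-Reasoning
    -- Beyond `Y` the last `d` numbers counted all lie in `K`, so translating `K` by `d` also costs
    -- exactly `d` elements.
    equal : ∀ e → count J? (m + Y + d + e) ≡ count Q? (m + Y + d + e)
    equal e = +-cancelʳ-≡ d _ _ (begin-equality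
      count J? (m + Y + d + e) + d       ≡⟨ cong (λ w → count J? w + d) (assoc m Y d e) ⟩
      count J? (m + (Y + d + e)) + d     ≡⟨ countK≡countJ+d (Y + d + e) ⟨
      count K? (m + (Y + d + e))         ≡⟨ cong (count K?) (rotate m Y d e) ⟩
      count K? (m + Y + e + d)           ≡⟨ count-+ K? (m + Y + e) d ⟩
      count K? (m + Y + e) + window K? d (m + Y + e)
        ≡⟨ cong (count K? (m + Y + e) +_) (count-all (λ i → K? (m + Y + e + i)) d
             λ i _ → full _ (≤-trans (m≤n+m Y m) (≤-trans (m≤m+n _ e) (m≤m+n _ i)))) ⟩
      count K? (m + Y + e) + d           ≡⟨ cong (_+ d) (cone-count-shift s t s>0 t>0 s d (m + Y + e)) ⟨
      count Q? (d + (m + Y + e)) + d     ≡⟨ cong (λ w → count Q? w + d) (commute m Y d e) ⟩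
      count Q? (m + Y + d + e) + d       ∎)
      where
      assoc : ∀ m Y d e → m + Y + d + e ≡ m + (Y + d + e)
      assoc = solve-∀
      rotate : ∀ m Y d e → m + (Y + d + e) ≡ m + Y + e + d
      rotate = solve-∀
      commute : ∀ m Y d e → d + (m + Y + e) ≡ m + Y + d + e
      commute = solve-∀
    eventually : ∀ Z → m + Y + d ≤ Z → count J? Z ≤ count Q? Z
    eventually Z ≤Z = subst (λ w → count J? w ≤ count Q? w) (m+[n∸m]≡n ≤Z)
      (≤-reflexive (equal (Z ∸ (m + Y + d))))

  dominated : ∀ x → 0 < x → atLeast x (elems β) ≤ atLeast (x + d) (elems Δ)
  dominated x x>0 with x ≤? m
  ... | no x≰m = ≤-trans (≤-reflexive (atLeast-none
          (All.map (λ z<1+m → ≤-<-trans (m<1+n⇒m≤n z<1+m) (≰⇒> x≰m)) β<1+m))) z≤n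
  ... | yes x≤m = begin
    atLeast x (elems β)           ≡⟨ cong (λ w → atLeast w (elems β)) (m∸[m∸n]≡n x≤1+m) ⟨
    atLeast (suc m ∸ k) (elems β) ≡⟨ countJ k k≤m ⟨
    count J? k                    ≤⟨ countJ≤countQ k ⟩
    count Q? k                    ≤⟨ countQ≤ ⟩
    atLeast (x + d) (elems Δ)     ∎
    where
    open ≤-Reasoning
    k : ℕ
    k = suc m ∸ x
    x≤1+m : x ≤ suc m
    x≤1+m = m≤n⇒m≤1+n x≤m
    k≤m : k ≤ m
    k≤m = ∸-monoʳ-≤ (suc m) x>0
    countQ≤ : count Q? k ≤ atLeast (x + d) (elems Δ)
    countQ≤ with d ≤? k
    -- A threshold `x + d` beyond `suc m` corresponds to a `k` below `d`, where the translate has no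
    -- elements yet.
    ... | no d≰k = ≤-trans (≤-reflexive (count-none Q? k λ z z<k q →
            d≰k (≤-trans (m≤n+m d s) (≤-trans (cone-≥ s t (s + d) z q) (<⇒≤ z<k))))) z≤n
    ... | yes d≤k = ≤-reflexive (begin-equality
      count Q? k                          ≡⟨ cong (count Q?) (m+[n∸m]≡n d≤k) ⟨
      count Q? (d + (k ∸ d))              ≡⟨ cone-count-shift s t s>0 t>0 s d (k ∸ d) ⟩
      count K? (k ∸ d)                    ≡⟨ countK (k ∸ d) (≤-trans (m∸n≤m k d) k≤m) ⟩
      atLeast (suc m ∸ (k ∸ d)) (elems Δ) ≡⟨ cong (λ w → atLeast w (elems Δ)) index ⟩
      atLeast (x + d) (elems Δ)           ∎)
      where
      -- Undoing the translation shortens the reflected range by `d`, which raises the threshold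
      -- from `x` to `x + d`.
      index : suc m ∸ (k ∸ d) ≡ x + d
      index = trans (cong (_∸ (k ∸ d)) (sym total)) (m+n∸n≡m (x + d) (k ∸ d))
        where
        total : x + d + (k ∸ d) ≡ suc m
        total = trans (+-assoc x d _) (trans (cong (x +_) (m+[n∸m]≡n d≤k)) (m+[n∸m]≡n x≤1+m))
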